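{- $\mathrm{P}^*_{\mathrm{lis}}=\mathrm{P/poly}$, where each Boolean function family $(f_n)_{n\in\mathbb N}$ is identified with the language $\{w\in\mathbb B^*: f_{|w|}(w)=T\}$.
   Context: $\mathbb B=\{T,F\}$. A primitive instruction is one of: a plain basic instruction $a$, a positive test instruction $+a$, a negative test instruction $-a$ (for a basic instruction $a$), a forward jump instruction $\#l$ ($l\in\mathbb N$), or the termination instruction $!$. An instruction sequence is a finite nonempty sequence $X=u_1;\dots;u_k$ of primitive instructions; its length is $|X|=k$. Basic instructions have the form $f.m$ where the focus $f$ is one of $\mathrm{in}{:}i$, $\mathrm{aux}{:}i$ ($i\ge 1$) or $\mathrm{out}$, each naming a Boolean register, and the method $m$ is one of $\mathrm{set}{:}T$, $\mathrm{set}{:}F$, $\mathrm{get}$. Executing $f.\mathrm{set}{:}b$ sets register $f$ to $b$ and yields reply $b$; executing $f.\mathrm{get}$ leaves the register unchanged and yields its content as reply. Execution of $X=u_1;\dots;u_k$: a counter starts at $1$. If the counter exceeds $k$, execution deadlocks. At position $i$: if $u_i=!$, execution terminates; if $u_i=\#l$, execution deadlocks if $l=0$ and otherwise the counter becomes $i+l$; if $u_i$ is $a$, $+a$ or $-a$, the basic instruction $a$ is executed yielding reply $r$, and the counter becomes $i+1$ for $u_i=a$; for $u_i=+a$ it becomes $i+1$ if $r=T$ and $i+2$ if $r=F$; for $u_i=-a$ it becomes $i+1$ if $r=F$ and $i+2$ if $r=T$. $\mathrm{IS}_{br}$ is the set of instruction sequences in which every basic instruction occurring belongs to $\{f.\mathrm{get}: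 f=\mathrm{in}{:}i \text{ or } f=\mathrm{aux}{:}i\}\cup\{f.\mathrm{set}{:}b: f=\mathrm{aux}{:}i \text{ or } f=\mathrm{out},\ b\in\mathbb B\}$. $X\in\mathrm{IS}_{br}$ computes $f:\mathbb B^n\to\mathbb B$ if for every $(b_1,\dots,b_n)\in\mathbb B^n$: when $X$ is executed with register $\mathrm{in}{:}j$ initialised to $b_j$ ($j\le n$) and all registers $\mathrm{aux}{:}i$ and $\mathrm{out}$ initialised to $F$, execution terminates (does not deadlock) without ever executing a basic instruction with focus $\mathrm{in}{:}j$ for $j>n$, and at termination register $\mathrm{out}$ contains $f(b_1,\dots,b_n)$. A Boolean function family is a sequence $(f_n)_{n\in\mathbb N}$ with $f_n:\mathbb B^n\to\mathbb B$. $\mathrm{P}^*_{\mathrm{lis}}$ is the class of Boolean function families $(f_n)$ for which there is a polynomial $h:\mathbb N\to\mathbb N$ such that for every $n$ there is $X\in\mathrm{IS}_{br}$ computing $f_n$ with $|X|\le h(n)$. $\mathrm{P/poly}$ is the usual class of languages decided by polynomial-size Boolean circuit families (equivalently, by polynomial-time Turing machines with polynomial-length advice). -}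

module Defs where

open import Data.Bool.Base using (Bool; true; false; if_then_else_; not; _∧_; _∨_)
open import Data.Fin.Base using (Fin)
open import Data.Integer.Base using (+_)
open import Data.List.Base using (List; []; _∷_; length)
open import Data.List.NonEmpty.Base as List⁺ using (List⁺)
open import Data.List.Relation.Unary.All using (All)
open import Data.Nat.Base using (ℕ; zero; suc; _+_; _≤_)
open import Data.Nat.Properties using (_≟_)
open import Data.Product.Base using (∃; _×_)
open import Data.Rational.Base as ℚ using (ℚ; 0ℚ)
open import Data.Unit.Base using (⊤)
open import Data.Vec.Base as Vec using (Vec; []; _∷_; fromList)
open import Level using (0ℓ)
open import Relation.Binary.Definitions using (DecidableEquality)
open import Relation.Binary.PropositionalEquality using (_≡_; refl; cong)
open import Relation.Nullary.Decidable using (yes; no; does; map′)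
open import Relation.Unary using (Pred; _∈_; _≐_)

-- Coefficients are listed from the constant term upwards.
evalPoly : List ℚ → ℚ → ℚ
evalPoly []       x = 0ℚ
evalPoly (c ∷ cs) x = c ℚ.+ x ℚ.* evalPoly cs x

-- A real polynomial that maps ℕ to ℕ has rational coefficients (but not
-- necessarily natural ones), so ℚ loses no polynomial function ℕ → ℕ.
IsPolynomial : Pred (ℕ → ℕ) 0ℓ
IsPolynomial h = ∃ λ cs → ∀ n → (+ h n) ℚ./ 1 ≡ evalPoly cs ((+ n) ℚ./ 1)

-- Registers are numbered from 1: "in:1+ i" is the register in:(i+1).
data Focus : Set where
  in:1+_  : ℕ → Focus
  aux:1+_ : ℕ → Focus
  out     : Focus

data Method : Set where
  set: : Bool → Method
  get  : Method

infix 6 _∙_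
data Basic : Set where
  _∙_ : Focus → Method → Basic

data Instr : Set where
  plain   : Basic → Instr
  posTest : Basic → Instr
  negTest : Basic → Instr
  jump    : ℕ → Instr
  halt    : Instr

InstrSeq : Set
InstrSeq = List⁺ Instr

data IsBrBasic : Pred Basic 0ℓ where
  in-get  : ∀ i   → IsBrBasic (in:1+ i ∙ get)
  aux-get : ∀ i   → IsBrBasic (aux:1+ i ∙ get)
  aux-set : ∀ i b → IsBrBasic (aux:1+ i ∙ set: b)
  out-set : ∀ b   → IsBrBasic (out ∙ set: b)

data IsBrInstr : Pred Instr 0ℓ where
  plain   : ∀ {a} → IsBrBasic a → IsBrInstr (plain a)
  posTest : ∀ {a} → IsBrBasic a → IsBrInstr (posTest a)
  negTest : ∀ {a} → IsBrBasic a → IsBrInstr (negTest a)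
  jump    : ∀ l → IsBrInstr (jump l)
  halt    : IsBrInstr halt

ISbr : Pred InstrSeq 0ℓ
ISbr X = All IsBrInstr (List⁺.toList X)

_≟ᶠ_ : DecidableEquality Focus
(in:1+ i)  ≟ᶠ (in:1+ j)  = map′ (cong in:1+_) (λ { refl → refl }) (i ≟ j)
(in:1+ _)  ≟ᶠ (aux:1+ _) = no λ ()
(in:1+ _)  ≟ᶠ out        = no λ ()
(aux:1+ _) ≟ᶠ (in:1+ _)  = no λ ()
(aux:1+ i) ≟ᶠ (aux:1+ j) = map′ (cong aux:1+_) (λ { refl → refl }) (i ≟ j)
(aux:1+ _) ≟ᶠ out        = no λ ()
out        ≟ᶠ (in:1+ _)  = no λ ()
out        ≟ᶠ (aux:1+ _) = no λ ()
out        ≟ᶠ out        = yes refl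

State : Set
State = Focus → Bool

_[_≔_] : State → Focus → Bool → State
(σ [ f ≔ b ]) g = if does (f ≟ᶠ g) then b else σ g

reply : Basic → State → Bool
reply (f ∙ set: b) σ = b
reply (f ∙ get)    σ = σ f

effect : Basic → State → State
effect (f ∙ set: b) σ = σ [ f ≔ b ]
effect (f ∙ get)    σ = σ

-- "us ⟨ i ⟩= u": the i-th element of us is u, counting from 1.
data _⟨_⟩=_ {A : Set} : List A → ℕ → A → Set where
  here  : ∀ {u us} → (u ∷ us) ⟨ 1 ⟩= u
  there : ∀ {u v us i} → us ⟨ i ⟩= u → (v ∷ us) ⟨ suc i ⟩= u

-- "Run X i σ as τ": started with counter i in state σ, execution of X
-- terminates in state τ, having executed the basic instructions as.
-- Execution is deterministic.  Deadlock is the absence of a rule: it occurs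
-- at jump 0 and when the counter exceeds the length of X.
data Run (X : InstrSeq) : ℕ → State → List Basic → State → Set where
  halt    : ∀ {i σ} →
            List⁺.toList X ⟨ i ⟩= halt →
            Run X i σ [] σ
  jump    : ∀ {i σ as τ l} →
            List⁺.toList X ⟨ i ⟩= jump (suc l) →
            Run X (i + suc l) σ as τ →
            Run X i σ as τ
  plain   : ∀ {i σ as τ a} →
            List⁺.toList X ⟨ i ⟩= plain a →
            Run X (i + 1) (effect a σ) as τ →
            Run X i σ (a ∷ as) τ
  posTest : ∀ {i σ as τ a} →
            List⁺.toList X ⟨ i ⟩= posTest a →
            Run X (if reply a σ then i + 1 else i + 2) (effect a σ) as τ →
            Run X i σ (a ∷ as) τ
  negTest : ∀ {i σ as τ a} →
            List⁺.toList X ⟨ i ⟩= negTest a →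
            Run X (if reply a σ then i + 2 else i + 1) (effect a σ) as τ →
            Run X i σ (a ∷ as) τ

InputWithin : ℕ → Pred Basic 0ℓ
InputWithin n (in:1+ i ∙ m)  = suc i ≤ n
InputWithin n (aux:1+ i ∙ m) = ⊤
InputWithin n (out ∙ m)      = ⊤

-- The value false for input registers beyond n is a dummy; Computes
-- forbids executing any instruction on them.
inputAt : ∀ {n} → Vec Bool n → ℕ → Bool
inputAt []       i       = false
inputAt (b ∷ bs) zero    = b
inputAt (b ∷ bs) (suc i) = inputAt bs i

initial : ∀ {n} → Vec Bool n → State
initial bs (in:1+ i)  = inputAt bs i
initial bs (aux:1+ i) = false
initial bs out        = false

_Computes_ : InstrSeq → ∀ {n} → (Vec Bool n → Bool) → Set
_Computes_ X {n} f = ∀ bs → ∃ λ as → ∃ λ τ →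
  Run X 1 (initial bs) as τ × All (InputWithin n) as × τ out ≡ f bs

Family : Set
Family = ∀ n → Vec Bool n → Bool

P*lis : Pred Family 0ℓ
P*lis f = ∃ λ h → IsPolynomial h ×
  (∀ n → ∃ λ X → X ∈ ISbr × X Computes f n × List⁺.length X ≤ h n)

Language : Set₁
Language = Pred (List Bool) 0ℓ

language : Family → Language
language f w = f (length w) (fromList w) ≡ true

languagesOf : Pred Family 0ℓ → Pred Language 0ℓ
languagesOf 𝓕 L = ∃ λ f → f ∈ 𝓕 × L ≐ language f

data Wire (n k : ℕ) : Set where
  input : Fin n → Wire n k
  gate  : Fin k → Wire n k

data Gate (n k : ℕ) : Set where
  const : Bool → Gate n k
  NOT   : Wire n k → Gate n k
  AND   : Wire n k → Wire n k → Gate n k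
  OR    : Wire n k → Wire n k → Gate n k

-- Acyclic circuits in topological order, with arbitrary fan-out.  The most
-- recent gate comes first, so gate indices are de Bruijn indices.
data Gates (n : ℕ) : ℕ → Set where
  []  : Gates n 0
  _∷_ : ∀ {k} → Gate n k → Gates n k → Gates n (suc k)

record Circuit (n : ℕ) : Set where
  constructor circuit
  field
    {size} : ℕ
    gates  : Gates n size
    output : Wire n size

open Circuit public using (size)

wireValue : ∀ {n k} → Vec Bool n → Vec Bool k → Wire n k → Bool
wireValue bs vs (input i) = Vec.lookup bs i
wireValue bs vs (gate j)  = Vec.lookup vs j

gateValue : ∀ {n k} → Vec Bool n → Vec Bool k → Gate n k → Bool
gateValue bs vs (const b) = b
gateValue bs vs (NOT x)   = not (wireValue bs vs x)
gateValue bs vs (AND x y) = wireValue bs vs x ∧ wireValue bs vs y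
gateValue bs vs (OR x y)  = wireValue bs vs x ∨ wireValue bs vs y

gateValues : ∀ {n k} → Vec Bool n → Gates n k → Vec Bool k
gateValues bs []       = []
gateValues bs (g ∷ gs) = gateValue bs (gateValues bs gs) g ∷ gateValues bs gs

evalCircuit : ∀ {n} → Circuit n → Vec Bool n → Bool
evalCircuit (circuit gs o) bs = wireValue bs (gateValues bs gs) o

CircuitFamily : Set
CircuitFamily = ∀ n → Circuit n

_Decides_ : CircuitFamily → Language → Set
C Decides L = L ≐ language (λ n → evalCircuit (C n))

P/poly : Pred Language 0ℓ
P/poly L = ∃ λ C → C Decides L ×
  (∃ λ h → IsPolynomial h × (∀ n → size (C n) ≤ h n))

{-# OPTIONS --safe #-}
-- Jumps only go forward, so an execution visits each position at most once and
-- in increasing order.  A circuit can therefore process the positions from left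
-- to right, keeping for every later position a wire telling whether control
-- enters it and for every register a wire with its current content; this takes
-- at most five gates per instruction.  Conversely, the gates of a circuit are
-- evaluated one after the other, at most four instructions per gate, each gate
-- storing its value in an auxiliary register of its own.
module Submission where

open import Defs
open import Data.Bool.Base using (Bool; true; false; if_then_else_; not; _∧_; _∨_)
open import Data.Bool.Properties using (∧-identityʳ; ∧-zeroʳ; ∨-identityʳ; ∨-zeroʳ; if-eta; if-float)
open import Data.Empty using (⊥)
open import Data.Fin.Base using (Fin; zero; suc; toℕ; fromℕ<)
open import Data.Fin.Properties using (toℕ<n; toℕ-fromℕ<)
open import Data.Integer.Base as ℤ using (+_)
import Data.Integer.Properties as ℤ
open import Data.List.Base using (List; []; _∷_; _++_; length; map; foldl)
open import Data.List.NonEmpty.Base as List⁺ using (_∷_; _++⁺_)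
open import Data.List.Properties using (foldl-++; length-++; ++-assoc)
open import Data.List.Relation.Unary.All using (All; []; _∷_)
import Data.List.Relation.Unary.All.Properties as All
open import Data.Maybe.Base using (Maybe; just; nothing)
import Data.Maybe.Properties as Maybe
open import Data.Nat.Base using (ℕ; zero; suc; _+_; _*_; _≤_; _<_; _≡ᵇ_; z≤n; s≤s)
open import Data.Nat.Properties
open import Data.Product.Base using (∃; _×_; _,_; proj₁)
open import Data.Rational.Base as ℚ using (ℚ)
import Data.Rational.Properties as ℚ
open import Data.Rational.Unnormalised.Base as ℚᵘ using (mkℚᵘ; *≡*)
import Data.Rational.Unnormalised.Properties as ℚᵘ
open import Data.Sum.Base using (_⊎_; inj₁; inj₂)
import Data.Sum.Properties as Sum
open import Data.Unit.Base using (tt)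
open import Data.Vec.Base using (Vec; []; _∷_; fromList; lookup)
open import Function.Base using (_∘_)
open import Relation.Binary.Definitions using (DecidableEquality)
open import Relation.Binary.PropositionalEquality
open import Relation.Nullary.Decidable using (yes; no; does; dec-true; dec-false)
open import Relation.Unary using (_≐_; _∈_)

-- Affine images of polynomials

fromNat : ℕ → ℚ
fromNat n = (+ n) ℚ./ 1

module _ where
  open import Relation.Binary.Reasoning.Setoid ℚᵘ.≃-setoid

  -- Normalisation by the gcd does not compute for a variable `n`, so sums and products are compared
  -- as unnormalised fractions with denominator 1.
  toℚᵘ-fromNat : ∀ n → ℚ.toℚᵘ (fromNat n) ℚᵘ.≃ mkℚᵘ (+ n) 0
  toℚᵘ-fromNat n = ℚ.toℚᵘ-fromℚᵘ (mkℚᵘ (+ n) 0)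

  fromNat-+ : ∀ m n → fromNat (m + n) ≡ fromNat m ℚ.+ fromNat n
  fromNat-+ m n = ℚ.toℚᵘ-injective (begin
    ℚ.toℚᵘ (fromNat (m + n))                     ≈⟨ toℚᵘ-fromNat (m + n) ⟩
    mkℚᵘ (+ (m + n)) 0                           ≈⟨ *≡* (cong (ℤ._* + 1) eq) ⟩
    mkℚᵘ (+ m) 0 ℚᵘ.+ mkℚᵘ (+ n) 0
      ≈⟨ ℚᵘ.+-cong (toℚᵘ-fromNat m) (toℚᵘ-fromNat n) ⟨
    ℚ.toℚᵘ (fromNat m) ℚᵘ.+ ℚ.toℚᵘ (fromNat n)
      ≈⟨ ℚ.toℚᵘ-homo-+ (fromNat m) (fromNat n) ⟨
    ℚ.toℚᵘ (fromNat m ℚ.+ fromNat n)             ∎)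
    where
    eq : + (m + n) ≡ + m ℤ.* + 1 ℤ.+ + n ℤ.* + 1
    eq = sym (cong₂ ℤ._+_ (ℤ.*-identityʳ (+ m)) (ℤ.*-identityʳ (+ n)))

  fromNat-* : ∀ m n → fromNat (m * n) ≡ fromNat m ℚ.* fromNat n
  fromNat-* m n = ℚ.toℚᵘ-injective (begin
    ℚ.toℚᵘ (fromNat (m * n))                     ≈⟨ toℚᵘ-fromNat (m * n) ⟩
    mkℚᵘ (+ (m * n)) 0                           ≈⟨ *≡* (cong (ℤ._* + 1) (ℤ.pos-* m n)) ⟩
    mkℚᵘ (+ m) 0 ℚᵘ.* mkℚᵘ (+ n) 0
      ≈⟨ ℚᵘ.*-cong (toℚᵘ-fromNat m) (toℚᵘ-fromNat n) ⟨
    ℚ.toℚᵘ (fromNat m) ℚᵘ.* ℚ.toℚᵘ (fromNat n)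
      ≈⟨ ℚ.toℚᵘ-homo-* (fromNat m) (fromNat n) ⟨
    ℚ.toℚᵘ (fromNat m ℚ.* fromNat n)             ∎)

addConstant : ℚ → List ℚ → List ℚ
addConstant d []       = d ∷ []
addConstant d (c ∷ cs) = d ℚ.+ c ∷ cs

evalPoly-addConstant : ∀ d cs x → evalPoly (addConstant d cs) x ≡ d ℚ.+ evalPoly cs x
evalPoly-addConstant d []       x = cong (d ℚ.+_) (ℚ.*-zeroʳ x)
evalPoly-addConstant d (c ∷ cs) x = ℚ.+-assoc d c (x ℚ.* evalPoly cs x)

evalPoly-scale : ∀ c cs x → evalPoly (map (c ℚ.*_) cs) x ≡ c ℚ.* evalPoly cs x
evalPoly-scale c []       x = sym (ℚ.*-zeroʳ c)
evalPoly-scale c (a ∷ cs) x = begin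
  c ℚ.* a ℚ.+ x ℚ.* evalPoly (map (c ℚ.*_) cs) x
    ≡⟨ cong (λ y → c ℚ.* a ℚ.+ x ℚ.* y) (evalPoly-scale c cs x) ⟩
  c ℚ.* a ℚ.+ x ℚ.* (c ℚ.* p)   ≡⟨ cong (c ℚ.* a ℚ.+_) (ℚ.*-assoc x c p) ⟨
  c ℚ.* a ℚ.+ x ℚ.* c ℚ.* p     ≡⟨ cong (λ y → c ℚ.* a ℚ.+ y ℚ.* p) (ℚ.*-comm x c) ⟩
  c ℚ.* a ℚ.+ c ℚ.* x ℚ.* p     ≡⟨ cong (c ℚ.* a ℚ.+_) (ℚ.*-assoc c x p) ⟩
  c ℚ.* a ℚ.+ c ℚ.* (x ℚ.* p)   ≡⟨ ℚ.*-distribˡ-+ c a (x ℚ.* p) ⟨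
  c ℚ.* (a ℚ.+ x ℚ.* p)         ∎
  where
  open ≡-Reasoning
  p = evalPoly cs x

-- Both translations enlarge the size at most affinely; this keeps their bounds polynomial.
isPolynomial-affine : ∀ d c {h} → IsPolynomial h → IsPolynomial (λ n → d + c * h n)
isPolynomial-affine d c {h} (cs , h≡) =
  addConstant (fromNat d) (map (fromNat c ℚ.*_) cs) , λ n → begin
    fromNat (d + c * h n)                            ≡⟨ fromNat-+ d (c * h n) ⟩
    fromNat d ℚ.+ fromNat (c * h n)                  ≡⟨ cong (fromNat d ℚ.+_) (fromNat-* c (h n)) ⟩
    fromNat d ℚ.+ fromNat c ℚ.* fromNat (h n)
      ≡⟨ cong (λ y → fromNat d ℚ.+ fromNat c ℚ.* y) (h≡ n) ⟩
    fromNat d ℚ.+ fromNat c ℚ.* evalPoly cs (fromNat n)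
      ≡⟨ cong (fromNat d ℚ.+_) (evalPoly-scale (fromNat c) cs (fromNat n)) ⟨
    fromNat d ℚ.+ evalPoly (map (fromNat c ℚ.*_) cs) (fromNat n)
      ≡⟨ evalPoly-addConstant (fromNat d) (map (fromNat c ℚ.*_) cs) (fromNat n) ⟨
    evalPoly (addConstant (fromNat d) (map (fromNat c ℚ.*_) cs)) (fromNat n) ∎
  where open ≡-Reasoning

-- Weakest preconditions

module _ (n : ℕ) (b : Bool) where

  -- `s` and `t` are the numbers of instructions skipped on replies T and F. The first conjunct
  -- carries the ban on inputs beyond `n`.
  branch : Basic → ℕ → ℕ → (ℕ → State → Set) → State → Set
  branch a s t k σ = InputWithin n a × k (if reply a σ then s else t) (effect a σ)

  -- k d is the precondition for continuing after skipping d instructions.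
  wpInstr : Instr → (ℕ → State → Set) → State → Set
  wpInstr (plain a)      k σ = branch a 0 0 k σ
  wpInstr (posTest a)    k σ = branch a 0 1 k σ
  wpInstr (negTest a)    k σ = branch a 1 0 k σ
  wpInstr (jump zero)    k σ = ⊥
  wpInstr (jump (suc l)) k σ = k l σ
  wpInstr halt           k σ = σ out ≡ b

  -- Jumps only go forward, so what follows an instruction depends on the tail alone and recursion
  -- on the list suffices. `d` counts the instructions still to be skipped; running off the end is a
  -- deadlock, hence `⊥`.
  wp : List Instr → ℕ → State → Set
  wp []       d       σ = ⊥
  wp (u ∷ us) zero    σ = wpInstr u (wp us) σ
  wp (u ∷ us) (suc d) σ = wp us d σ

  -- Skipping `j` instructions of the tail behind `u` amounts to skipping `suc (d + j)` of the whole
  -- list, which is how the counter of `Run` moves.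
  wp-at : ∀ {us d u σ} → us ⟨ suc d ⟩= u →
          wpInstr u (λ j → wp us (suc (d + j))) σ → wp us d σ
  wp-at {d = zero}  here      w = w
  wp-at {d = zero}  (there ())
  wp-at {d = suc d} (there p) w = wp-at p w

  -- Induction on the run. Counters start at 1 and skips at 0; `i ≡ suc d` is a hypothesis because
  -- the counters in `Run` are sums and conditionals.
  Run⇒wp : ∀ {X i d σ as τ} → i ≡ suc d → Run X i σ as τ →
           All (InputWithin n) as → τ out ≡ b → wp (List⁺.toList X) d σ
  Run⇒wp refl (halt p) [] q = wp-at p q
  Run⇒wp {d = d} refl (jump {l = l} p r) oks q =
    wp-at p (Run⇒wp (+-suc (suc d) l) r oks q)
  Run⇒wp {d = d} {σ} refl (plain {a = a} p r) (ok ∷ oks) q =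
    wp-at p (ok , Run⇒wp eq r oks q)
    where
    eq : suc d + 1 ≡ suc (suc (d + (if reply a σ then 0 else 0)))
    eq = trans (+-suc (suc d) 0) (cong (λ j → suc (suc (d + j))) (sym (if-eta (reply a σ))))
  Run⇒wp {d = d} {σ} refl (posTest {a = a} p r) (ok ∷ oks) q =
    wp-at p (ok , Run⇒wp eq r oks q)
    where
    eq : (if reply a σ then suc d + 1 else suc d + 2) ≡ suc (suc (d + (if reply a σ then 0 else 1)))
    eq = trans (sym (if-float (λ j → suc d + suc j) (reply a σ))) (+-suc (suc d) _)
  Run⇒wp {d = d} {σ} refl (negTest {a = a} p r) (ok ∷ oks) q =
    wp-at p (ok , Run⇒wp eq r oks q)
    where
    eq : (if reply a σ then suc d + 2 else suc d + 1) ≡ suc (suc (d + (if reply a σ then 1 else 0)))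
    eq = trans (sym (if-float (λ j → suc d + suc j) (reply a σ))) (+-suc (suc d) _)

  Terminates : InstrSeq → ℕ → State → Set
  Terminates X i σ = ∃ λ as → ∃ λ τ → Run X i σ as τ × All (InputWithin n) as × τ out ≡ b

  -- `us` is found in `X` at offset `p`: the recursion descends through suffixes while `X`, to which
  -- `Run` refers, stays fixed.
  SuffixAt : List Instr → ℕ → InstrSeq → Set
  SuffixAt us p X = ∀ {j v} → us ⟨ suc j ⟩= v → List⁺.toList X ⟨ p + suc j ⟩= v

  suffixAt-tail : ∀ {u us} p {X} → SuffixAt (u ∷ us) p X → SuffixAt us (suc p) X
  suffixAt-tail p {X} s {j} {v} q =
    subst (λ i → List⁺.toList X ⟨ i ⟩= v) (+-suc p (suc j)) (s (there q))

  mutual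
    -- Every instruction other than `halt` passes control into the tail, so the recursion on `us` is
    -- structural.
    wp⇒Run : ∀ {X} us p {d σ} → SuffixAt us p X → wp us d σ → Terminates X (p + suc d) σ
    wp⇒Run (u ∷ us) p {zero} s w = wp⇒Run-head u us p s w
    wp⇒Run {X} (u ∷ us) p {suc d} {σ} s w =
      subst (λ i → Terminates X i σ) (sym (+-suc p (suc d)))
        (wp⇒Run us (suc p) (suffixAt-tail p s) w)

    wp⇒Run-tail : ∀ {X u} us p {d σ} → SuffixAt (u ∷ us) p X → wp us d σ →
                  Terminates X (p + 1 + suc d) σ
    wp⇒Run-tail {X} us p {d} {σ} s w =
      subst (λ i → Terminates X i σ) (cong (_+ suc d) (+-comm 1 p))
        (wp⇒Run us (suc p) (suffixAt-tail p s) w)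

    wp⇒Run-head : ∀ {X} u us p {σ} → SuffixAt (u ∷ us) p X → wpInstr u (wp us) σ →
                  Terminates X (p + 1) σ
    wp⇒Run-head (plain a) us p {σ} s (ok , w)
      with as , τ , r , oks , q ← wp⇒Run-tail us p s w =
      a ∷ as , τ ,
      plain (s here)
        -- Both replies skip nothing, so the conditional collapses.
        (subst (λ j → Run _ (p + 1 + suc j) (effect a σ) as τ) (if-eta (reply a σ)) r) ,
      ok ∷ oks , q
    wp⇒Run-head (posTest a) us p {σ} s (ok , w)
      with as , τ , r , oks , q ← wp⇒Run-tail us p s w =
      a ∷ as , τ ,
      posTest (s here)
        (subst (λ i → Run _ i (effect a σ) as τ)
          (if-float (λ j → p + 1 + suc j) (reply a σ)) r) ,
      ok ∷ oks , q
    wp⇒Run-head (negTest a) us p {σ} s (ok , w)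
      with as , τ , r , oks , q ← wp⇒Run-tail us p s w =
      a ∷ as , τ ,
      negTest (s here)
        (subst (λ i → Run _ i (effect a σ) as τ)
          (if-float (λ j → p + 1 + suc j) (reply a σ)) r) ,
      ok ∷ oks , q
    wp⇒Run-head (jump (suc l)) us p s w
      with as , τ , r , oks , q ← wp⇒Run-tail us p s w =
      as , τ , jump (s here) r , oks , q
    wp⇒Run-head halt us p {σ} s w = [] , σ , halt (s here) , [] , w

-- From circuits to instruction sequences

-- Reverses the de Bruijn numbering: a gate keeps its register when later gates are added, and the
-- gate on top of `k` others gets number `k`.
address : ∀ {k} → Fin k → ℕ
address {suc k} zero    = k
address {suc k} (suc j) = address j

address<k : ∀ {k} (j : Fin k) → address j < k
address<k {suc k} zero    = n<1+n k
address<k {suc k} (suc j) = m<n⇒m<1+n (address<k j)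

focus : ∀ {n k} → Wire n k → Focus
focus (input i) = in:1+ toℕ i
focus (gate j)  = aux:1+ address j

-- Auxiliary registers are initially F, so only the value T has to be stored.
gateCode : ∀ {n k} → Gate n k → List Instr
gateCode {k = k} (const b) = plain (aux:1+ k ∙ set: b) ∷ []
gateCode {k = k} (NOT x) =
  negTest (focus x ∙ get) ∷ plain (aux:1+ k ∙ set: true) ∷ []
gateCode {k = k} (AND x y) =
  negTest (focus x ∙ get) ∷ jump 3 ∷
  posTest (focus y ∙ get) ∷ plain (aux:1+ k ∙ set: true) ∷ []
gateCode {k = k} (OR x y) =
  posTest (focus x ∙ get) ∷ jump 2 ∷
  posTest (focus y ∙ get) ∷ plain (aux:1+ k ∙ set: true) ∷ []

gatesCode : ∀ {n k} → Gates n k → List Instr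
gatesCode []       = []
gatesCode (g ∷ gs) = gatesCode gs ++ gateCode g

-- On reply F the store is skipped and `out` keeps its initial value F.
outputCode : ∀ {n k} → Wire n k → InstrSeq
outputCode o = posTest (focus o ∙ get) ∷ plain (out ∙ set: true) ∷ halt ∷ []

circuitCode : ∀ {n} → Circuit n → InstrSeq
circuitCode (circuit gs o) = gatesCode gs ++⁺ outputCode o

-- Form and length of the code for circuits

focus-isBr : ∀ {n k} (x : Wire n k) → IsBrBasic (focus x ∙ get)
focus-isBr (input i) = in-get (toℕ i)
focus-isBr (gate j)  = aux-get (address j)

gateCode-isBr : ∀ {n k} (g : Gate n k) → All IsBrInstr (gateCode g)
gateCode-isBr (const b) = plain (aux-set _ b) ∷ []
gateCode-isBr (NOT x)   = negTest (focus-isBr x) ∷ plain (aux-set _ true) ∷ []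
gateCode-isBr (AND x y) =
  negTest (focus-isBr x) ∷ jump 3 ∷ posTest (focus-isBr y) ∷ plain (aux-set _ true) ∷ []
gateCode-isBr (OR x y)  =
  posTest (focus-isBr x) ∷ jump 2 ∷ posTest (focus-isBr y) ∷ plain (aux-set _ true) ∷ []

gatesCode-isBr : ∀ {n k} (gs : Gates n k) → All IsBrInstr (gatesCode gs)
gatesCode-isBr []       = []
gatesCode-isBr (g ∷ gs) = All.++⁺ (gatesCode-isBr gs) (gateCode-isBr g)

toList-++⁺ : ∀ {A : Set} (xs : List A) ys → List⁺.toList (xs ++⁺ ys) ≡ xs ++ List⁺.toList ys
toList-++⁺ []       ys = refl
toList-++⁺ (x ∷ xs) ys = cong (x ∷_) (toList-++⁺ xs ys)

circuitCode-isBr : ∀ {n} (C : Circuit n) → circuitCode C ∈ ISbr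
circuitCode-isBr (circuit gs o) =
  subst (All IsBrInstr) (sym (toList-++⁺ (gatesCode gs) _))
    (All.++⁺ (gatesCode-isBr gs) (posTest (focus-isBr o) ∷ plain (out-set true) ∷ halt ∷ []))

length-gateCode : ∀ {n k} (g : Gate n k) → length (gateCode g) ≤ 4
length-gateCode (const b) = s≤s z≤n
length-gateCode (NOT x)   = s≤s (s≤s z≤n)
length-gateCode (AND x y) = ≤-refl
length-gateCode (OR x y)  = ≤-refl

length-gatesCode : ∀ {n k} (gs : Gates n k) → length (gatesCode gs) ≤ 4 * k
length-gatesCode []               = z≤n
length-gatesCode {k = suc k} (g ∷ gs) = begin
  length (gatesCode gs ++ gateCode g)          ≡⟨ length-++ (gatesCode gs) ⟩
  length (gatesCode gs) + length (gateCode g)  ≤⟨ +-mono-≤ (length-gatesCode gs) (length-gateCode g) ⟩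
  4 * k + 4                                    ≡⟨ +-comm (4 * k) 4 ⟩
  4 + 4 * k                                    ≡⟨ *-suc 4 k ⟨
  4 * suc k                                    ∎
  where open ≤-Reasoning

length-circuitCode : ∀ {n} (C : Circuit n) → List⁺.length (circuitCode C) ≤ 3 + 4 * size C
length-circuitCode (circuit {k} gs o) = begin
  length (List⁺.toList (gatesCode gs ++⁺ post))    ≡⟨ cong length (toList-++⁺ (gatesCode gs) post) ⟩
  length (gatesCode gs ++ List⁺.toList post)       ≡⟨ length-++ (gatesCode gs) ⟩
  length (gatesCode gs) + 3                        ≤⟨ +-monoˡ-≤ 3 (length-gatesCode gs) ⟩
  4 * k + 3                                        ≡⟨ +-comm (4 * k) 3 ⟩
  3 + 4 * k                                        ∎
  where
  open ≤-Reasoning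
  post = outputCode o

-- Correctness of the code for circuits

inputAt-toℕ : ∀ {n} (bs : Vec Bool n) i → inputAt bs (toℕ i) ≡ lookup bs i
inputAt-toℕ (b ∷ bs) zero    = refl
inputAt-toℕ (b ∷ bs) (suc i) = inputAt-toℕ bs i

-- The invariant between the blocks of two gates. `fresh` lets a gate of value F store nothing;
-- `out-F` does the same for the output.
record Evaluated {n k} (bs : Vec Bool n) (vs : Vec Bool k) (σ : State) : Set where
  field
    wire  : ∀ x → σ (focus {n} {k} x) ≡ wireValue bs vs x
    fresh : ∀ {m} → k ≤ m → σ (aux:1+ m) ≡ false
    out-F : σ out ≡ false

open Evaluated

evaluated-initial : ∀ {n} (bs : Vec Bool n) → Evaluated bs [] (initial bs)
evaluated-initial bs .wire (input i) = inputAt-toℕ bs i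
evaluated-initial bs .fresh _        = refl
evaluated-initial bs .out-F          = refl

module _ {n k} {bs : Vec Bool n} {vs : Vec Bool k} {σ : State} {v : Bool}
         (ev : Evaluated bs vs σ) where

  evaluated-keep : false ≡ v → Evaluated bs (v ∷ vs) σ
  evaluated-keep _    .wire (input i)      = ev .wire (input i)
  evaluated-keep refl .wire (gate zero)    = ev .fresh ≤-refl
  evaluated-keep _    .wire (gate (suc j)) = ev .wire (gate j)
  evaluated-keep _    .fresh k<m           = ev .fresh (<⇒≤ k<m)
  evaluated-keep _    .out-F               = ev .out-F

  update-other : ∀ {b m} → k ≢ m → (σ [ aux:1+ k ≔ b ]) (aux:1+ m) ≡ σ (aux:1+ m)
  update-other {b} {m} k≢m rewrite dec-false (k ≟ m) k≢m = refl

  evaluated-set : ∀ {b} → b ≡ v → Evaluated bs (v ∷ vs) (σ [ aux:1+ k ≔ b ])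
  evaluated-set _    .wire (input i)      = ev .wire (input i)
  evaluated-set refl .wire (gate zero)    rewrite dec-true (k ≟ k) refl = refl
  -- Earlier gates have addresses below `k`, so the store leaves their registers alone.
  evaluated-set _    .wire (gate (suc j)) =
    trans (update-other (≢-sym (<⇒≢ (address<k j)))) (ev .wire (gate j))
  evaluated-set _    .fresh k<m = trans (update-other (<⇒≢ k<m)) (ev .fresh (<⇒≤ k<m))
  evaluated-set _    .out-F     = ev .out-F

focus-within : ∀ {n k} (x : Wire n k) → InputWithin n (focus x ∙ get)
focus-within (input i) = toℕ<n i
focus-within (gate j)  = tt

module _ {n} (b : Bool) {bs : Vec Bool n} where

  -- Every path leaves the block exactly at its end. In `AND` a false `x` takes `jump 3` past the
  -- store; in `OR` a true `x` takes `jump 2` to the store.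
  gateCode-correct : ∀ {k} {vs : Vec Bool k} {σ} g post →
    Evaluated bs vs σ →
    (∀ {σ′} → Evaluated bs (gateValue bs vs g ∷ vs) σ′ → wp n b post 0 σ′) →
    wp n b (gateCode g ++ post) 0 σ
  gateCode-correct (const true)  post ev k = tt , k (evaluated-set ev refl)
  gateCode-correct (const false) post ev k = tt , k (evaluated-set ev refl)
  gateCode-correct {σ = σ} (NOT x) post ev k with σ (focus x) | ev .wire x
  ... | true  | eq = focus-within x , k (evaluated-keep ev (cong not eq))
  ... | false | eq = focus-within x , tt , k (evaluated-set ev (cong not eq))
  gateCode-correct {σ = σ} (AND x y) post ev k with σ (focus x) | ev .wire x
  ... | false | eq = focus-within x , k (evaluated-keep ev (cong₂ _∧_ eq (ev .wire y)))
  ... | true  | eq with σ (focus y) | ev .wire y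
  ...   | true  | eq′ = focus-within x , focus-within y , tt , k (evaluated-set ev (cong₂ _∧_ eq eq′))
  ...   | false | eq′ = focus-within x , focus-within y , k (evaluated-keep ev (cong₂ _∧_ eq eq′))
  gateCode-correct {σ = σ} (OR x y) post ev k with σ (focus x) | ev .wire x
  ... | true  | eq = focus-within x , tt , k (evaluated-set ev (cong₂ _∨_ eq (ev .wire y)))
  ... | false | eq with σ (focus y) | ev .wire y
  ...   | true  | eq′ = focus-within x , focus-within y , tt , k (evaluated-set ev (cong₂ _∨_ eq eq′))
  ...   | false | eq′ = focus-within x , focus-within y , k (evaluated-keep ev (cong₂ _∨_ eq eq′))

  -- Quantifying over the code `post` that follows lets the induction move the block of the newest
  -- gate into `post`.
  gatesCode-correct : ∀ {k} (gs : Gates n k) post →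
    (∀ {σ} → Evaluated bs (gateValues bs gs) σ → wp n b post 0 σ) →
    wp n b (gatesCode gs ++ post) 0 (initial bs)
  gatesCode-correct []       post k = k (evaluated-initial bs)
  gatesCode-correct (g ∷ gs) post k =
    subst (λ us → wp n b us 0 (initial bs)) (sym (++-assoc (gatesCode gs) (gateCode g) post))
      (gatesCode-correct gs (gateCode g ++ post) (λ ev → gateCode-correct g post ev k))

circuitCode-wp : ∀ {n} (C : Circuit n) bs →
  wp n (evalCircuit C bs) (List⁺.toList (circuitCode C)) 0 (initial bs)
circuitCode-wp {n} C@(circuit gs o) bs =
  subst (λ us → wp n (evalCircuit C bs) us 0 (initial bs))
    (sym (toList-++⁺ (gatesCode gs) (outputCode o)))
    (gatesCode-correct (evalCircuit C bs) gs _ output)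
  where
  output : ∀ {σ} → Evaluated bs (gateValues bs gs) σ →
           wp n (evalCircuit C bs) (List⁺.toList (outputCode o)) 0 σ
  output {σ} ev with σ (focus o) | ev .wire o
  ... | true  | eq = focus-within o , tt , eq
  ... | false | eq = focus-within o , trans (ev .out-F) eq

circuitCode-computes : ∀ {n} (C : Circuit n) → circuitCode C Computes evalCircuit C
circuitCode-computes {n} C bs =
  wp⇒Run n (evalCircuit C bs) (List⁺.toList (circuitCode C)) 0 (λ p → p) (circuitCode-wp C bs)

-- From instruction sequences to circuits

-- pos i records whether control is at position i.
Var : Set
Var = Maybe (ℕ ⊎ Focus)

pattern pos i = just (inj₁ i)
pattern reg f = just (inj₂ f)
pattern tmp   = nothing

_≟ᵛ_ : DecidableEquality Var
_≟ᵛ_ = Maybe.≡-dec (Sum.≡-dec _≟_ _≟ᶠ_)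

assign : ∀ {A : Set} → (Var → A) → Var → A → Var → A
assign e v a w = if does (v ≟ᵛ w) then a else e w

data Op : Set where
  NOT    : Var → Op
  AND OR : Var → Var → Op

opValue : (Var → Bool) → Op → Bool
opValue e (NOT v)   = not (e v)
opValue e (AND v w) = e v ∧ e w
opValue e (OR v w)  = e v ∨ e w

infix 6 _:=_
data Assignment : Set where
  _:=_ : Var → Op → Assignment

step : (Var → Bool) → Assignment → Var → Bool
step e (v := o) = assign e v (opValue e o)

exec : (Var → Bool) → List Assignment → Var → Bool
exec = foldl step

-- Compilation of assignments into gates

weaken : ∀ {n k} → Wire n k → Wire n (suc k)
weaken (input i) = input i
weaken (gate j)  = gate (suc j)

opGate : ∀ {n k} → (Var → Wire n k) → Op → Gate n k
opGate ρ (NOT v)   = NOT (ρ v)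
opGate ρ (AND v w) = AND (ρ v) (ρ w)
opGate ρ (OR v w)  = OR (ρ v) (ρ w)

-- Each assignment becomes one new gate. `ρ` gives the wire that holds the current content of a
-- variable, so reassignment only redirects `ρ`.
compile : ∀ {n k} → (Var → Wire n k) → Gates n k → List Assignment → Circuit n
compile ρ gs []             = circuit gs (ρ (reg out))
compile ρ gs ((v := o) ∷ p) = compile (assign (weaken ∘ ρ) v (gate zero)) (opGate ρ o ∷ gs) p

compile-size : ∀ {n k} (ρ : Var → Wire n k) gs p → size (compile ρ gs p) ≡ k + length p
compile-size {k = k} ρ gs []             = sym (+-identityʳ k)
compile-size {k = k} ρ gs ((v := o) ∷ p) =
  trans (compile-size _ _ p) (sym (+-suc k (length p)))

module _ {n} (bs : Vec Bool n) where

  weaken-value : ∀ {k} (vs : Vec Bool k) v x → wireValue bs (v ∷ vs) (weaken x) ≡ wireValue bs vs x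
  weaken-value vs v (input i) = refl
  weaken-value vs v (gate j)  = refl

  Represents : ∀ {k} → (Var → Wire n k) → Gates n k → (Var → Bool) → Set
  Represents ρ gs e = ∀ v → wireValue bs (gateValues bs gs) (ρ v) ≡ e v

  opGate-value : ∀ {k} {ρ : Var → Wire n k} {gs e} → Represents ρ gs e → ∀ o →
                 gateValue bs (gateValues bs gs) (opGate ρ o) ≡ opValue e o
  opGate-value ρ≈e (NOT v)   = cong not (ρ≈e v)
  opGate-value ρ≈e (AND v w) = cong₂ _∧_ (ρ≈e v) (ρ≈e w)
  opGate-value ρ≈e (OR v w)  = cong₂ _∨_ (ρ≈e v) (ρ≈e w)

  compile-correct : ∀ {k} {ρ : Var → Wire n k} {gs e} → Represents ρ gs e → ∀ p →
                    evalCircuit (compile ρ gs p) bs ≡ exec e p (reg out)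
  compile-correct ρ≈e []             = ρ≈e (reg out)
  compile-correct {ρ = ρ} {gs} {e} ρ≈e ((v := o) ∷ p) = compile-correct represents p
    where
    represents : Represents (assign (weaken ∘ ρ) v (gate zero)) (opGate ρ o ∷ gs) (step e (v := o))
    represents w with does (v ≟ᵛ w)
    ... | true  = opGate-value ρ≈e o
    ... | false = trans (weaken-value (gateValues bs gs) _ (ρ w)) (ρ≈e w)

-- Assignments that simulate instructions

enter : ℕ → ℕ → List Assignment
-- A position can be the target of several earlier ones, so its flag is accumulated by a
-- disjunction.
enter i d = pos (suc i + d) := OR (pos (suc i + d)) (pos i) ∷ []

enterIf : ℕ → ℕ → Var → List Assignment
enterIf i d v =
  tmp             := AND (pos i) v ∷
  pos (suc i + d) := OR (pos (suc i + d)) tmp ∷ []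

enterUnless : ℕ → ℕ → Var → List Assignment
enterUnless i d v =
  tmp             := NOT v ∷
  tmp             := AND (pos i) tmp ∷
  pos (suc i + d) := OR (pos (suc i + d)) tmp ∷ []

-- The store is guarded by the flag of `i`: if control is elsewhere, both formulas return the old
-- content.
store : ℕ → Focus → Bool → List Assignment
store i f true  = reg f := OR (reg f) (pos i) ∷ []
store i f false = tmp := NOT (pos i) ∷ reg f := AND (reg f) tmp ∷ []

-- s and t are the numbers of instructions skipped on replies T and F.
branchCode : ℕ → ℕ → ℕ → Basic → List Assignment
branchCode i s t (f ∙ set: b) = store i f b ++ enter i (if b then s else t)
branchCode i s t (f ∙ get)    = enterIf i s (reg f) ++ enterUnless i t (reg f)

instrCode : ℕ → Instr → List Assignment
instrCode i (plain a)      = branchCode i 0 0 a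
instrCode i (posTest a)    = branchCode i 0 1 a
instrCode i (negTest a)    = branchCode i 1 0 a
instrCode i (jump zero)    = []
instrCode i (jump (suc l)) = enter i l
instrCode i halt           = []

seqCode : ℕ → List Instr → List Assignment
seqCode i []       = []
seqCode i (u ∷ us) = instrCode i u ++ seqCode (suc i) us

length-branchCode : ∀ i s t a → length (branchCode i s t a) ≤ 5
length-branchCode i s t (f ∙ set: true)  = s≤s (s≤s z≤n)
length-branchCode i s t (f ∙ set: false) = s≤s (s≤s (s≤s z≤n))
-- Two assignments for reply T and three for reply F.
length-branchCode i s t (f ∙ get)        = ≤-refl

length-instrCode : ∀ i u → length (instrCode i u) ≤ 5
length-instrCode i (plain a)      = length-branchCode i 0 0 a
length-instrCode i (posTest a)    = length-branchCode i 0 1 a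
length-instrCode i (negTest a)    = length-branchCode i 1 0 a
length-instrCode i (jump zero)    = z≤n
length-instrCode i (jump (suc l)) = s≤s z≤n
length-instrCode i halt           = z≤n

length-seqCode : ∀ i us → length (seqCode i us) ≤ 5 * length us
length-seqCode i []       = z≤n
length-seqCode i (u ∷ us) = begin
  length (instrCode i u ++ seqCode (suc i) us)            ≡⟨ length-++ (instrCode i u) ⟩
  length (instrCode i u) + length (seqCode (suc i) us)
    ≤⟨ +-mono-≤ (length-instrCode i u) (length-seqCode (suc i) us) ⟩
  5 + 5 * length us                                       ≡⟨ *-suc 5 (length us) ⟨
  5 * suc (length us)                                     ∎
  where open ≤-Reasoning

-- nothing means that control is at none of the positions.
at : Maybe ℕ → ℕ → Bool
at (just d) j = d ≡ᵇ j
at nothing  j = false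

-- Effect of one instruction and of its code

after : Instr → State → State
after (plain a)   = effect a
after (posTest a) = effect a
after (negTest a) = effect a
after (jump l) σ  = σ
after halt     σ  = σ

-- Counted from the instruction behind `u`. Termination and the deadlock of `jump 0` both give
-- `nothing`; `wp` rules out the latter.
next : Instr → State → Maybe ℕ
next (plain a)      σ = just (if reply a σ then 0 else 0)
next (posTest a)    σ = just (if reply a σ then 0 else 1)
next (negTest a)    σ = just (if reply a σ then 1 else 0)
next (jump zero)    σ = nothing
next (jump (suc l)) σ = just l
next halt           σ = nothing

-- The flags are abstracted to a function `x` on all positions, so that each induction step can
-- shift it by one.
assign-pos : ∀ (x : ℕ → Bool) a i d j →
  (if i + d ≡ᵇ i + j then x (i + d) ∨ a else x (i + j)) ≡ x (i + j) ∨ (a ∧ (d ≡ᵇ j))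
assign-pos x true  zero zero    zero    = refl
assign-pos x false zero zero    zero    = refl
assign-pos x true  zero zero    (suc j) = sym (∨-identityʳ (x (suc j)))
assign-pos x false zero zero    (suc j) = sym (∨-identityʳ (x (suc j)))
assign-pos x true  zero (suc d) zero    = sym (∨-identityʳ (x zero))
assign-pos x false zero (suc d) zero    = sym (∨-identityʳ (x zero))
assign-pos x a     zero (suc d) (suc j) = assign-pos (x ∘ suc) a zero d j
assign-pos x a     (suc i) d    j       = assign-pos (x ∘ suc) a i d j

-- Targets lie strictly behind `i`, so the flag of `i` is still intact when `enterUnless` reads it
-- after `enterIf`.
pos-unchanged : ∀ {A : Set} i d {x y : A} → (if suc i + d ≡ᵇ i then x else y) ≡ y
pos-unchanged zero    d = refl
pos-unchanged (suc i) d = pos-unchanged i d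

enter-pos : ∀ i d e j →
  exec e (enter i d) (pos (suc i + j)) ≡ e (pos (suc i + j)) ∨ (e (pos i) ∧ at (just d) j)
enter-pos i d e j = assign-pos (λ q → e (pos q)) (e (pos i)) (suc i) d j

enterIf-pos : ∀ i d f e j →
  exec e (enterIf i d (reg f)) (pos (suc i + j)) ≡
  e (pos (suc i + j)) ∨ ((e (pos i) ∧ e (reg f)) ∧ at (just d) j)
enterIf-pos i d f e j = assign-pos (λ q → e (pos q)) (e (pos i) ∧ e (reg f)) (suc i) d j

enterUnless-pos : ∀ i d f e j →
  exec e (enterUnless i d (reg f)) (pos (suc i + j)) ≡
  e (pos (suc i + j)) ∨ ((e (pos i) ∧ not (e (reg f))) ∧ at (just d) j)
enterUnless-pos i d f e j =
  assign-pos (λ q → e (pos q)) (e (pos i) ∧ not (e (reg f))) (suc i) d j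

store-reg : ∀ i f b e g →
  exec e (store i f b) (reg g) ≡
  (if e (pos i) then (if does (f ≟ᶠ g) then b else e (reg g)) else e (reg g))
store-reg i f true e g with f ≟ᶠ g | e (pos i)
... | yes refl | true  = ∨-zeroʳ (e (reg f))
... | yes refl | false = ∨-identityʳ (e (reg f))
... | no _     | true  = refl
... | no _     | false = refl
store-reg i f false e g with f ≟ᶠ g | e (pos i)
... | yes refl | true  = ∧-zeroʳ (e (reg f))
... | yes refl | false = ∧-identityʳ (e (reg f))
... | no _     | true  = refl
... | no _     | false = refl

store-pos : ∀ i f b e j → exec e (store i f b) (pos j) ≡ e (pos j)
store-pos i f true  e j = refl
store-pos i f false e j = refl

-- The effect of the code for one instruction at position i, whether or not
-- control is there.
record Simulates (i : ℕ) (p : List Assignment) (m : State → Maybe ℕ) (τ : State → State) : Set where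
  field
    regs : ∀ e {σ} → (∀ f → e (reg f) ≡ σ f) → ∀ f →
           exec e p (reg f) ≡ (if e (pos i) then τ σ f else σ f)
    poss : ∀ e {σ} → (∀ f → e (reg f) ≡ σ f) → ∀ j →
           exec e p (pos (suc i + j)) ≡ e (pos (suc i + j)) ∨ (e (pos i) ∧ at (m σ) j)

open Simulates

-- The reply of a `set:` is known in advance, so one entry suffices; a `get` changes no register, so
-- both of its entries see the same reply.
branchCode-simulates : ∀ i s t a →
  Simulates i (branchCode i s t a) (λ σ → just (if reply a σ then s else t)) (effect a)
branchCode-simulates i s t (f ∙ set: b) .regs e {σ} e≈σ g
  rewrite foldl-++ step e (store i f b) (enter i (if b then s else t))
        | store-reg i f b e g | e≈σ g = refl
branchCode-simulates i s t (f ∙ set: b) .poss e {σ} e≈σ j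
  rewrite foldl-++ step e (store i f b) (enter i (if b then s else t))
        | enter-pos i (if b then s else t) (exec e (store i f b)) j
        | store-pos i f b e (suc i + j) | store-pos i f b e i = refl
branchCode-simulates i s t (f ∙ get) .regs e e≈σ g = trans (e≈σ g) (sym (if-eta (e (pos i))))
branchCode-simulates i s t (f ∙ get) .poss e {σ} e≈σ j
  rewrite enterUnless-pos i t f (exec e (enterIf i s (reg f))) j
        | enterIf-pos i s f e j
        | pos-unchanged i s {e (pos (suc i + s)) ∨ e (pos i) ∧ e (reg f)} {e (pos i)}
        | e≈σ f = cases (e (pos (suc i + j))) (e (pos i)) (σ f)
  where
  -- The conditions `c ∧ r` and `c ∧ not r` exclude each other, so at most one entry contributes.
  cases : ∀ x c r → (x ∨ (c ∧ r) ∧ at (just s) j) ∨ (c ∧ not r) ∧ at (just t) j ≡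
                    x ∨ c ∧ at (just (if r then s else t)) j
  cases true  c     r     = refl
  cases false false r     = refl
  cases false true  true  = ∨-identityʳ _
  cases false true  false = refl

instrCode-simulates : ∀ i u → Simulates i (instrCode i u) (next u) (after u)
instrCode-simulates i (plain a)   = branchCode-simulates i 0 0 a
instrCode-simulates i (posTest a) = branchCode-simulates i 0 1 a
instrCode-simulates i (negTest a) = branchCode-simulates i 1 0 a
instrCode-simulates i (jump zero)    .regs e e≈σ f = trans (e≈σ f) (sym (if-eta (e (pos i))))
instrCode-simulates i (jump zero)    .poss e e≈σ j =
  sym (trans (cong (e (pos (suc i + j)) ∨_) (∧-zeroʳ (e (pos i)))) (∨-identityʳ _))
instrCode-simulates i (jump (suc l)) .regs e e≈σ f = trans (e≈σ f) (sym (if-eta (e (pos i))))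
instrCode-simulates i (jump (suc l)) .poss e e≈σ j = enter-pos i l e j
instrCode-simulates i halt           .regs e e≈σ f = trans (e≈σ f) (sym (if-eta (e (pos i))))
instrCode-simulates i halt           .poss e e≈σ j =
  sym (trans (cong (e (pos (suc i + j)) ∨_) (∧-zeroʳ (e (pos i)))) (∨-identityʳ _))

-- Simulation of a whole instruction sequence

module _ (n : ℕ) (b : Bool) where

  -- Once execution has terminated, the remaining assignments leave `out` alone, so it has to be
  -- right already.
  wpMaybe : List Instr → Maybe ℕ → State → Set
  wpMaybe us (just d) σ = wp n b us d σ
  wpMaybe us nothing  σ = σ out ≡ b

  wp-next : ∀ u us {σ} → wp n b (u ∷ us) 0 σ → wpMaybe us (next u σ) (after u σ)
  wp-next (plain a)      us (_ , w) = w
  wp-next (posTest a)    us (_ , w) = w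
  wp-next (negTest a)    us (_ , w) = w
  wp-next (jump (suc l)) us w       = w
  wp-next halt           us w       = w

  -- Induction on `us` for every place `m` of control: finished, at the head, or further on. Only in
  -- the second case is the flag of the head T and its code active.
  seqCode-correct : ∀ i us m {e σ} →
    (∀ f → e (reg f) ≡ σ f) → (∀ j → e (pos (i + j)) ≡ at m j) →
    wpMaybe us m σ → exec e (seqCode i us) (reg out) ≡ b
  -- A place `just d` behind the end would be a deadlock, excluded by `wp`.
  seqCode-correct i []       nothing e≈σ _   w = trans (e≈σ out) w
  seqCode-correct i (u ∷ us) m {e} {σ} e≈σ e≈m w
    rewrite foldl-++ step e (instrCode i u) (seqCode (suc i) us) = go m e≈m w
    where
    sim = instrCode-simulates i u
    e′  = exec e (instrCode i u)

    here≡ : ∀ m → (∀ j → e (pos (i + j)) ≡ at m j) → e (pos i) ≡ at m 0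
    here≡ m e≈m = trans (cong (λ q → e (pos q)) (sym (+-identityʳ i))) (e≈m 0)

    later≡ : ∀ m → (∀ j → e (pos (i + j)) ≡ at m j) → ∀ j → e (pos (suc i + j)) ≡ at m (suc j)
    later≡ m e≈m j = trans (cong (λ q → e (pos q)) (sym (+-suc i j))) (e≈m (suc j))

    regs′ : ∀ m → (∀ j → e (pos (i + j)) ≡ at m j) →
            ∀ f → e′ (reg f) ≡ (if at m 0 then after u σ f else σ f)
    regs′ m e≈m f = trans (sim .regs e e≈σ f) (cong (if_then after u σ f else σ f) (here≡ m e≈m))

    poss′ : ∀ m → (∀ j → e (pos (i + j)) ≡ at m j) →
            ∀ j → e′ (pos (suc i + j)) ≡ at m (suc j) ∨ (at m 0 ∧ at (next u σ) j)
    poss′ m e≈m j =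
      trans (sim .poss e e≈σ j)
        (cong₂ (λ x y → x ∨ (y ∧ at (next u σ) j)) (later≡ m e≈m j) (here≡ m e≈m))

    go : ∀ m → (∀ j → e (pos (i + j)) ≡ at m j) → wpMaybe (u ∷ us) m σ →
         exec e′ (seqCode (suc i) us) (reg out) ≡ b
    go nothing m≈ w = seqCode-correct (suc i) us nothing (regs′ nothing m≈) (poss′ nothing m≈) w
    go (just zero) m≈ w =
      seqCode-correct (suc i) us (next u σ) (regs′ (just zero) m≈) (poss′ (just zero) m≈) (wp-next u us w)
    -- The head is inactive, so its contribution to the flags is F and the distance just drops by
    -- one.
    go (just (suc d)) m≈ w =
      seqCode-correct (suc i) us (just d) (regs′ (just (suc d)) m≈)
        (λ j → trans (poss′ (just (suc d)) m≈ j) (∨-identityʳ _)) w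

-- Initial wires and the resulting circuit

inputAt-≥ : ∀ {n} (bs : Vec Bool n) {i} → n ≤ i → inputAt bs i ≡ false
inputAt-≥ []       _         = refl
inputAt-≥ (b ∷ bs) (s≤s n≤i) = inputAt-≥ bs n≤i

-- By the de Bruijn numbering, gate 0 is the constant T and gate 1 the constant F.
initialGates : ∀ {n} → Gates n 2
initialGates = const true ∷ const false ∷ []

initialWire : ∀ {n} → Var → Wire n 2
initialWire (pos zero)         = gate zero
initialWire {n} (reg (in:1+ i)) with i <? n
... | yes i<n = input (fromℕ< i<n)
-- Agrees with the dummy value of `inputAt` beyond `n`.
... | no _    = gate (suc zero)
initialWire _                  = gate (suc zero)

initialEnv : ∀ {n} → Vec Bool n → Var → Bool
initialEnv bs (pos i) = 0 ≡ᵇ i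
initialEnv bs (reg f) = initial bs f
initialEnv bs tmp     = false

initialWire-represents : ∀ {n} (bs : Vec Bool n) →
                         Represents bs initialWire initialGates (initialEnv bs)
initialWire-represents bs (pos zero)     = refl
initialWire-represents bs (pos (suc i))  = refl
initialWire-represents {n} bs (reg (in:1+ i)) with i <? n
... | yes i<n =
  trans (sym (inputAt-toℕ bs (fromℕ< i<n))) (cong (inputAt bs) (toℕ-fromℕ< i<n))
... | no i≮n  = sym (inputAt-≥ bs (≮⇒≥ i≮n))
initialWire-represents bs (reg (aux:1+ i)) = refl
initialWire-represents bs (reg out)      = refl
initialWire-represents bs tmp            = refl

seqCircuit : ∀ n → InstrSeq → Circuit n
seqCircuit n X = compile initialWire initialGates (seqCode 0 (List⁺.toList X))

seqCircuit-size : ∀ n X → size (seqCircuit n X) ≤ 2 + 5 * List⁺.length X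
seqCircuit-size n X = begin
  size (seqCircuit n X)                  ≡⟨ compile-size {n} initialWire initialGates p ⟩
  2 + length p                           ≤⟨ +-monoʳ-≤ 2 (length-seqCode 0 (List⁺.toList X)) ⟩
  2 + 5 * List⁺.length X                 ∎
  where
  open ≤-Reasoning
  p = seqCode 0 (List⁺.toList X)

-- The terminating run is first turned into `wp`, which recurses on the list just as `seqCode` does;
-- control starts at position 0.
seqCircuit-correct : ∀ {n X} {f : Vec Bool n → Bool} → X Computes f →
                     ∀ bs → evalCircuit (seqCircuit n X) bs ≡ f bs
seqCircuit-correct {n} {X} {f} computes bs with as , τ , r , oks , q ← computes bs =
  trans (compile-correct bs (initialWire-represents bs) (seqCode 0 (List⁺.toList X)))
    (seqCode-correct n (f bs) 0 (List⁺.toList X) (just 0) (λ _ → refl) (λ _ → refl)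
      (Run⇒wp n (f bs) refl r oks q))

-- Equality of the two classes

theorem6 : languagesOf P*lis ≐ P/poly
theorem6 = P*lis⊆P/poly , P/poly⊆P*lis
  where
  P*lis⊆P/poly : ∀ {L} → L ∈ languagesOf P*lis → L ∈ P/poly
  P*lis⊆P/poly (f , (h , poly , seqs) , L⊆f , f⊆L) =
    C ,
    ((λ {w} w∈L → trans (C≡f w) (L⊆f w∈L)) , (λ {w} w∈C → f⊆L (trans (sym (C≡f w)) w∈C))) ,
    (λ n → 2 + 5 * h n) , isPolynomial-affine 2 5 {h} poly , size≤
    where
    C : CircuitFamily
    C n = seqCircuit n (proj₁ (seqs n))

    C≡f : ∀ w → evalCircuit (C (length w)) (fromList w) ≡ f (length w) (fromList w)
    C≡f w with X , _ , computes , _ ← seqs (length w) = seqCircuit-correct computes (fromList w)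

    size≤ : ∀ n → size (C n) ≤ 2 + 5 * h n
    size≤ n with X , _ , _ , X≤h ← seqs n =
      ≤-trans (seqCircuit-size n X) (+-monoʳ-≤ 2 (*-monoʳ-≤ 5 X≤h))

  P/poly⊆P*lis : ∀ {L} → L ∈ P/poly → L ∈ languagesOf P*lis
  P/poly⊆P*lis (C , decides , h , poly , C≤h) =
    -- With the functions of the circuits as the family, `decides` is already the required equality
    -- of languages.
    (λ n → evalCircuit (C n)) ,
    ((λ n → 3 + 4 * h n) , isPolynomial-affine 3 4 {h} poly , λ n →
      circuitCode (C n) , circuitCode-isBr (C n) , circuitCode-computes (C n) ,
      ≤-trans (length-circuitCode (C n)) (+-monoʳ-≤ 3 (*-monoʳ-≤ 4 (C≤h n)))) ,
    decides
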